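{- Let $\Lambda=\{\lambda_n\}_{n\ge 0}$ be a sequence of real numbers with $\lambda_0=1$, and let $n\ge 1$ be a natural number. Then: (i) $V_n[\Lambda]=\overline{T}_n[\Lambda]\,\overline{T}_{n-1}[\Lambda]\cdots\overline{T}_1[\Lambda]$. (ii) $V_n^{ -1}[\Lambda]=\overline{T}_1^{ -1}[\Lambda]\,\overline{T}_2^{ -1}[\Lambda]\cdots\overline{T}_n^{ -1}[\Lambda]$.
   Context: Rows and columns of matrices are indexed from $0$. Given a sequence $\Lambda=\{\lambda_n\}_{n\ge0}$, define numbers $a_{i,j}$ ($i,j\ge 0$) by $a_{i,0}=\lambda_i$ for $i\ge 0$, $a_{i,j}=0$ for $i<j$, and $$a_{i,j}=\sum_{l=j-1}^{i-1}\lambda_{i-1-l}\,a_{l,j-1}\qquad (i\ge j\ge 1).$$ The vertically-recurrent matrix associated with $\Lambda$, of order $(n+1)\times(n+1)$, is $V_n[\Lambda]=[a_{i,j}]_{0\le i,j\le n}$; $V_n^{ -1}[\Lambda]$ denotes its inverse. For $k\ge 0$, the lower triangular Toeplitz matrix $T_k[\Lambda]$ is the $(k+1)\times(k+1)$ matrix whose $(i,j)$ entry is $\lambda_{i-j}$ if $i\ge j$ and $0$ if $i<j$. For fixed $n$ and $1\le k\le n$, $\overline{T}_k[\Lambda]$ is the $(n+1)\times(n+1)$ block-diagonal matrix $$\overline{T}_k[\Lambda]=\begin{bmatrix} I_{n-k}&0\\ 0&T_k[\Lambda]\end{bmatrix},$$ where $I_r$ is the identity matrix of order $r$ (so $\overline{T}_n[\Lambda]=T_n[\Lambda]$),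 and $\overline{T}_k^{ -1}[\Lambda]$ is its inverse. -}

module Defs where

open import Algebra.Bundles using (CommutativeRing)
open import Data.Bool.Base using (if_then_else_)
open import Data.Fin.Base using (Fin; toℕ; cast; splitAt)
open import Data.Fin.Properties using (toℕ<n) renaming (_≟_ to _≟ᶠ_)
open import Data.Nat.Base using (ℕ; zero; suc; _≤_; _∸_) renaming (_+_ to _+ᴺ_)
open import Data.Nat.Properties using (_<?_; m∸n+n≡m; +-suc)
open import Data.Sum.Base using (inj₁; inj₂)
open import Data.Vec.Functional using (Vector; foldr)
open import Level using (_⊔_)
open import Relation.Binary.PropositionalEquality.Core using (_≡_; sym; trans; cong)
open import Relation.Nullary.Decidable.Core using (does)
import Algebra.Properties.Monoid.Sum as MonoidSum

block-size : ∀ {n k} → k ≤ n → suc n ≡ (n ∸ k) +ᴺ suc k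
block-size {n} {k} k≤n =
  trans (cong suc (sym (m∸n+n≡m k≤n))) (sym (+-suc (n ∸ k) k))

-- The standard library has no real numbers, so entries are taken in an
-- arbitrary commutative ring R.
module Matrices {c ℓ} (R : CommutativeRing c ℓ) where

  open CommutativeRing R
  open MonoidSum +-monoid using (sum)

  Matrix : ℕ → Set c
  Matrix n = Vector (Vector Carrier n) n

  infix 4 _≋_
  _≋_ : ∀ {n} → Matrix n → Matrix n → Set ℓ
  A ≋ B = ∀ i j → A i j ≈ B i j

  I : ∀ {n} → Matrix n
  I i j = if does (i ≟ᶠ j) then 1# else 0#

  infixl 7 _·_
  _·_ : ∀ {n} → Matrix n → Matrix n → Matrix n
  (A · B) i j = sum (λ l → A i l * B l j)

  -- ∏ F = F₀ · F₁ · ⋯ · Fₘ₋₁, in this order.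
  ∏ : ∀ {n m} → Vector (Matrix n) m → Matrix n
  ∏ = foldr _·_ I

  record Invertible {n} (A : Matrix n) : Set (c ⊔ ℓ) where
    field
      inverse  : Matrix n
      inverseʳ : A · inverse ≋ I
      inverseˡ : inverse · A ≋ I

  open Invertible public using (inverse)

  blockDiag : ∀ {p q} → Matrix p → Matrix q → Matrix (p +ᴺ q)
  blockDiag {p} A B i j with splitAt p i | splitAt p j
  ... | inj₁ i′ | inj₁ j′ = A i′ j′
  ... | inj₂ i′ | inj₂ j′ = B i′ j′
  ... | inj₁ _  | inj₂ _  = 0#
  ... | inj₂ _  | inj₁ _  = 0#

  -- f lo + f (lo + 1) + ⋯ + f hi (empty when hi < lo).
  sumFromTo : ℕ → ℕ → (ℕ → Carrier) → Carrier
  sumFromTo lo hi f = sum {suc hi ∸ lo} (λ m → f (lo +ᴺ toℕ m))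

  -- The column index is suc j, so "j - 1" in the usual formula
  --   aᵢⱼ = Σ_{l=j-1}^{i-1} λ_{i-1-l} a_{l,j-1}
  -- is j here.  The truncated i ∸ 1 is only reached when i ≥ 1.
  a : (ℕ → Carrier) → ℕ → ℕ → Carrier
  a Λ i zero    = Λ i
  a Λ i (suc j) =
    if does (i <? suc j) then 0#
    else sumFromTo j (i ∸ 1) (λ l → Λ (i ∸ 1 ∸ l) * a Λ l j)

  V : (ℕ → Carrier) → ∀ n → Matrix (suc n)
  V Λ n i j = a Λ (toℕ i) (toℕ j)

  T : (ℕ → Carrier) → ∀ k → Matrix (suc k)
  T Λ k i j = if does (toℕ i <? toℕ j) then 0# else Λ (toℕ i ∸ toℕ j)

  T̄ : (ℕ → Carrier) → ∀ n k → k ≤ n → Matrix (suc n)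
  T̄ Λ n k k≤n i j =
    blockDiag (I {n ∸ k}) (T Λ k)
      (cast (block-size k≤n) i) (cast (block-size k≤n) j)

  -- The family T̄₁ , … , T̄ₙ: position i : Fin n holds the matrix of index i + 1.
  T̄s : (ℕ → Carrier) → ∀ n → Vector (Matrix (suc n)) n
  T̄s Λ n i = T̄ Λ n (suc (toℕ i)) (toℕ<n i)

{-# OPTIONS --safe #-}

-- The j-th column of V has generating function xʲΛ(x)ʲ⁺¹, so multiplying
-- 1 ⊕ Vₙ₋₁ by the Toeplitz matrix Tₙ of Λ gives Vₙ.  Since T̄ₖ of order n + 1 is
-- 1 ⊕ T̄ₖ of order n for k < n, iterating Vₙ = Tₙ (1 ⊕ Vₙ₋₁) yields the
-- factorisation.  Each Tₖ is invertible, being a bordering of Tₖ₋₁ by a column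
-- with top entry λ₀ = 1, and the inverse of the product is the product of the
-- inverses in the opposite order.
module Submission where

open import Defs
open import Algebra.Bundles using (CommutativeRing; Monoid)
open import Data.Bool.Base using (if_then_else_)
open import Data.Fin.Base using (Fin; zero; suc; toℕ; fromℕ; opposite; inject₁; cast; splitAt)
open import Data.Fin.Properties
  using (toℕ<n; toℕ-fromℕ; toℕ-inject₁; cast-is-id)
open import Data.Nat.Base using (ℕ; zero; suc; _≤_; _<_; _∸_; z≤n; s≤s; s≤s⁻¹)
  renaming (_+_ to _+ᴺ_)
open import Data.Nat.Properties
  using (_<?_; n∸n≡0; +-∸-assoc; m≤n⇒m∸n≡0; m≤n⇒m<n∨m≡n; <⇒≱; ≰⇒>; m≤n+o⇒m∸n≤o)
open import Data.Product.Base using (_×_; _,_; proj₁; proj₂)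
open import Data.Sum.Base using (inj₁; inj₂)
open import Data.Vec.Functional using (Vector; reverse)
open import Function.Base using (_∘_)
open import Relation.Binary.PropositionalEquality.Core as ≡ using (_≡_)
open import Relation.Nullary.Decidable.Core using (Dec; does; yes; no)
open import Relation.Nullary.Negation.Core using (¬_; contradiction)
import Algebra.Properties.Monoid as MonoidProperties
import Algebra.Properties.Monoid.Sum as MonoidSum
import Algebra.Properties.Semiring.Sum as SemiringSum
import Relation.Binary.Reasoning.Setoid as SetoidReasoning

-- Two-sided inverses and reversed products in a monoid.

module MutualInverses {c ℓ} (M : Monoid c ℓ) where

  open Monoid M
  open MonoidProperties M using (cancelᶜ)
  open MonoidSum M using (sum; sum-init-last)
  open SetoidReasoning setoid

  infix 4 _⁻¹≈_
  _⁻¹≈_ : Carrier → Carrier → Set ℓ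
  x ⁻¹≈ y = x ∙ y ≈ ε × y ∙ x ≈ ε

  ⁻¹≈-respˡ : ∀ {x x′ y} → x ≈ x′ → x ⁻¹≈ y → x′ ⁻¹≈ y
  ⁻¹≈-respˡ x≈x′ (xy , yx) =
    trans (∙-congʳ (sym x≈x′)) xy , trans (∙-congˡ (sym x≈x′)) yx

  ⁻¹≈-unique : ∀ {x y z} → x ⁻¹≈ y → x ⁻¹≈ z → y ≈ z
  ⁻¹≈-unique {x} {y} {z} (_ , yx) (xz , _) = begin
    y            ≈⟨ identityʳ y ⟨
    y ∙ ε        ≈⟨ ∙-congˡ xz ⟨
    y ∙ (x ∙ z)  ≈⟨ assoc y x z ⟨
    (y ∙ x) ∙ z  ≈⟨ ∙-congʳ yx ⟩
    ε ∙ z        ≈⟨ identityˡ z ⟩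
    z            ∎

  -- Here `sum` is the ordered monoid product. `reverse xs` starts with the last entry of `xs`,
  -- while `sum-init-last` puts the last entry of `ys` at the end. So `P` and `Q` meet in the middle
  -- of one product, and `y` and `x` in the middle of the other.
  product-reverse-⁻¹≈ : ∀ {n} (xs ys : Vector Carrier n) →
    (∀ i → xs i ⁻¹≈ ys i) → sum (reverse xs) ⁻¹≈ sum ys
  product-reverse-⁻¹≈ {zero}  xs ys inv = identityˡ ε , identityˡ ε
  product-reverse-⁻¹≈ {suc n} xs ys inv = right , left
    where
    x = xs (fromℕ n)
    y = ys (fromℕ n)
    P = sum (reverse (xs ∘ inject₁))
    Q = sum (ys ∘ inject₁)
    ih = product-reverse-⁻¹≈ (xs ∘ inject₁) (ys ∘ inject₁) (inv ∘ inject₁)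

    right : (x ∙ P) ∙ sum ys ≈ ε
    right = begin
      (x ∙ P) ∙ sum ys   ≈⟨ ∙-congˡ (sum-init-last ys) ⟩
      (x ∙ P) ∙ (Q ∙ y)  ≈⟨ cancelᶜ (proj₁ ih) x y ⟩
      x ∙ y              ≈⟨ proj₁ (inv (fromℕ n)) ⟩
      ε                  ∎

    left : sum ys ∙ (x ∙ P) ≈ ε
    left = begin
      sum ys ∙ (x ∙ P)   ≈⟨ ∙-congʳ (sum-init-last ys) ⟩
      (Q ∙ y) ∙ (x ∙ P)  ≈⟨ cancelᶜ (proj₂ (inv (fromℕ n))) Q P ⟩
      Q ∙ P              ≈⟨ proj₂ ih ⟩
      ε                  ∎

-- The monoid of square matrices.

module MatrixProperties {c ℓ} (R : CommutativeRing c ℓ) where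

  open CommutativeRing R hiding (zero)
  open Matrices R
  open SemiringSum semiring
    using (sum; sum-cong-≋; sum-replicate-zero; *-distribˡ-sum; *-distribʳ-sum; ∑-comm; ∑-distrib-+)
  open SetoidReasoning setoid

  sum-zero : ∀ {n} (f : Vector Carrier n) → (∀ i → f i ≈ 0#) → sum f ≈ 0#
  sum-zero {n} f f≈0 = trans (sum-cong-≋ f≈0) (sum-replicate-zero n)

  ·-cong : ∀ {n} {A A′ B B′ : Matrix n} → A ≋ A′ → B ≋ B′ → A · B ≋ A′ · B′
  ·-cong A≋A′ B≋B′ i j = sum-cong-≋ λ l → *-cong (A≋A′ i l) (B≋B′ l j)

  infixr 7 _·ᵥ_
  _·ᵥ_ : ∀ {n} → Matrix n → Vector Carrier n → Vector Carrier n
  (A ·ᵥ v) i = sum (λ l → A i l * v l)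

  -- Interchange of two finite sums. The vector form gives `·-assoc` column by column and also
  -- handles the border columns in `border-invertible`.
  ·-·ᵥ-assoc : ∀ {n} (A B : Matrix n) (v : Vector Carrier n) →
    ∀ i → ((A · B) ·ᵥ v) i ≈ (A ·ᵥ B ·ᵥ v) i
  ·-·ᵥ-assoc A B v i = begin
    sum (λ l → sum (λ k → A i k * B k l) * v l)
      ≈⟨ sum-cong-≋ (λ l → *-distribʳ-sum (v l) (λ k → A i k * B k l)) ⟩
    sum (λ l → sum (λ k → A i k * B k l * v l))
      ≈⟨ ∑-comm (λ l k → A i k * B k l * v l) ⟩
    sum (λ k → sum (λ l → A i k * B k l * v l))
      ≈⟨ sum-cong-≋ (λ k → sum-cong-≋ λ l → *-assoc (A i k) (B k l) (v l)) ⟩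
    sum (λ k → sum (λ l → A i k * (B k l * v l)))
      ≈⟨ sum-cong-≋ (λ k → *-distribˡ-sum (A i k) (λ l → B k l * v l)) ⟨
    sum (λ k → A i k * sum (λ l → B k l * v l))
      ∎

  ·-assoc : ∀ {n} (A B C : Matrix n) → (A · B) · C ≋ A · (B · C)
  ·-assoc A B C i j = ·-·ᵥ-assoc A B (λ l → C l j) i

  I-·ᵥ : ∀ {n} (i : Fin n) (f : Vector Carrier n) → (I ·ᵥ f) i ≈ f i
  I-·ᵥ zero f = begin
    1# * f zero + sum (λ l → 0# * f (suc l))  ≈⟨ +-cong (*-identityˡ _) (sum-zero (λ l → 0# * f (suc l)) (λ l → zeroˡ (f (suc l)))) ⟩
    f zero + 0#                               ≈⟨ +-identityʳ _ ⟩
    f zero                                    ∎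
  I-·ᵥ (suc i) f = begin
    0# * f zero + sum (λ l → I i l * f (suc l))  ≈⟨ +-cong (zeroˡ _) (I-·ᵥ i (f ∘ suc)) ⟩
    0# + f (suc i)                               ≈⟨ +-identityˡ _ ⟩
    f (suc i)                                    ∎

  I-sym : ∀ {n} (i j : Fin n) → I i j ≡ I j i
  I-sym zero    zero    = ≡.refl
  I-sym zero    (suc j) = ≡.refl
  I-sym (suc i) zero    = ≡.refl
  I-sym (suc i) (suc j) = I-sym i j

  ·-identityˡ : ∀ {n} (A : Matrix n) → I · A ≋ A
  ·-identityˡ A i j = I-·ᵥ i (λ l → A l j)

  ·-identityʳ : ∀ {n} (A : Matrix n) → A · I ≋ A
  ·-identityʳ A i j = begin
    sum (λ l → A i l * I l j)  ≈⟨ sum-cong-≋ (λ l → trans (*-comm _ _) (*-congʳ (reflexive (I-sym l j)))) ⟩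
    sum (λ l → I j l * A i l)  ≈⟨ I-·ᵥ j (A i) ⟩
    A i j                      ∎

  -- The `sum` of this monoid unfolds to `∏`, so facts about monoid products apply to ordered matrix
  -- products.
  matrixMonoid : ℕ → Monoid c ℓ
  matrixMonoid n = record
    { Carrier  = Matrix n
    ; _≈_      = _≋_
    ; _∙_      = _·_
    ; ε        = I
    ; isMonoid = record
      { isSemigroup = record
        { isMagma = record
          { isEquivalence = record
            { refl  = λ i j → refl
            ; sym   = λ p i j → sym (p i j)
            ; trans = λ p q i j → trans (p i j) (q i j)
            }
          ; ∙-cong = λ {A} {A′} {B} {B′} → ·-cong {A = A} {A′} {B} {B′}
          }
        ; assoc = ·-assoc
        }
      ; identity = ·-identityˡ , ·-identityʳ
      }
    }

  module Inv {n} = MutualInverses (matrixMonoid n)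
  open Inv using (_⁻¹≈_) public

  ⁻¹≈⇒Invertible : ∀ {n} (A B : Matrix n) → A ⁻¹≈ B → Invertible A
  ⁻¹≈⇒Invertible A B (AB , BA) =
    record { inverse = B ; inverseʳ = AB ; inverseˡ = BA }

  inverse-⁻¹≈ : ∀ {n} {A : Matrix n} (A⁻¹ : Invertible A) → A ⁻¹≈ inverse A⁻¹
  inverse-⁻¹≈ A⁻¹ = Invertible.inverseʳ A⁻¹ , Invertible.inverseˡ A⁻¹

  Invertible-resp : ∀ {n} {A B : Matrix n} → A ≋ B → Invertible A → Invertible B
  Invertible-resp {n} {A} {B} A≋B A⁻¹ =
    ⁻¹≈⇒Invertible B (inverse A⁻¹) (Inv.⁻¹≈-respˡ {x = A} A≋B (inverse-⁻¹≈ A⁻¹))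

  -- Bordered matrices and their inverses.

  border : ∀ {n} → Vector Carrier n → Matrix n → Matrix (suc n)
  border v A zero    zero    = 1#
  border v A zero    (suc j) = 0#
  border v A (suc i) zero    = v i
  border v A (suc i) (suc j) = A i j

  1⊕_ : ∀ {n} → Matrix n → Matrix (suc n)
  1⊕_ = border (λ _ → 0#)

  border-cong : ∀ {n} {v w : Vector Carrier n} {A B : Matrix n} →
    (∀ i → v i ≈ w i) → A ≋ B → border v A ≋ border w B
  border-cong v≈w A≋B zero    zero    = refl
  border-cong v≈w A≋B zero    (suc j) = refl
  border-cong v≈w A≋B (suc i) zero    = v≈w i
  border-cong v≈w A≋B (suc i) (suc j) = A≋B i j

  1⊕-cong : ∀ {n} {A B : Matrix n} → A ≋ B → 1⊕ A ≋ 1⊕ B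
  1⊕-cong = border-cong (λ _ → refl)

  1⊕-I : ∀ {n} → 1⊕ I {n} ≋ I
  1⊕-I zero    zero    = refl
  1⊕-I zero    (suc j) = refl
  1⊕-I (suc i) zero    = refl
  1⊕-I (suc i) (suc j) = refl

  -- Block multiplication. For two bordered matrices to be inverse, it leaves one condition on the
  -- columns and one on the blocks.
  border-· : ∀ {n} (v w : Vector Carrier n) (A B : Matrix n) →
    border v A · border w B ≋ border (λ i → v i + (A ·ᵥ w) i) (A · B)
  border-· v w A B zero zero =
    trans (+-cong (*-identityˡ 1#) (sum-zero (λ l → 0# * w l) (λ l → zeroˡ (w l)))) (+-identityʳ 1#)
  border-· v w A B zero (suc j) =
    trans (+-cong (zeroʳ 1#) (sum-zero (λ l → 0# * B l j) (λ l → zeroˡ (B l j)))) (+-identityʳ 0#)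
  border-· v w A B (suc i) zero = +-congʳ (*-identityʳ (v i))
  border-· v w A B (suc i) (suc j) = trans (+-congʳ (zeroʳ (v i))) (+-identityˡ _)

  1⊕-· : ∀ {n} (A B : Matrix n) → 1⊕ (A · B) ≋ 1⊕ A · 1⊕ B
  1⊕-· A B i j = sym (trans (border-· _ _ A B i j) (border-cong zero-column (λ _ _ → refl) i j))
    where
    zero-column : ∀ i → 0# + sum (λ l → A i l * 0#) ≈ 0#
    zero-column i = trans (+-identityˡ _) (sum-zero (λ l → A i l * 0#) (λ l → zeroʳ (A i l)))

  1⊕-∏ : ∀ {n m} (F : Vector (Matrix n) m) → 1⊕ ∏ F ≋ ∏ (λ i → 1⊕ F i)
  1⊕-∏ {m = zero}  F = 1⊕-I
  1⊕-∏ {m = suc m} F i j = trans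
    (1⊕-· (F zero) (∏ (F ∘ suc)) i j)
    (·-cong {A = 1⊕ F zero} (λ _ _ → refl) (1⊕-∏ (F ∘ suc)) i j)

  border-invertible : ∀ {n} (v : Vector Carrier n) {A : Matrix n} →
    Invertible A → Invertible (border v A)
  border-invertible v {A} A⁻¹ = ⁻¹≈⇒Invertible (border v A) (border w B) (right , left)
    where
    B = inverse A⁻¹
    -- The right inverse needs `v + A w = 0`, which `w = B (- v)` solves since `A · B` is `I`.
    w = B ·ᵥ (-_ ∘ v)

    Aw≈-v : ∀ i → (A ·ᵥ w) i ≈ - v i
    Aw≈-v i = begin
      (A ·ᵥ w) i               ≈⟨ ·-·ᵥ-assoc A B (-_ ∘ v) i ⟨
      ((A · B) ·ᵥ (-_ ∘ v)) i  ≈⟨ sum-cong-≋ (λ l → *-congʳ (Invertible.inverseʳ A⁻¹ i l)) ⟩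
      (I ·ᵥ (-_ ∘ v)) i        ≈⟨ I-·ᵥ i (-_ ∘ v) ⟩
      - v i                    ∎

    -- The column condition for the left inverse follows from linearity of `B` alone.
    w+Bv≈0 : ∀ i → w i + (B ·ᵥ v) i ≈ 0#
    w+Bv≈0 i = trans (sym (∑-distrib-+ (λ l → B i l * - v l) (λ l → B i l * v l)))
      (sum-zero _ λ l → begin
        B i l * - v l + B i l * v l  ≈⟨ distribˡ (B i l) (- v l) (v l) ⟨
        B i l * (- v l + v l)        ≈⟨ *-congˡ (-‿inverseˡ (v l)) ⟩
        B i l * 0#                   ≈⟨ zeroʳ (B i l) ⟩
        0#                           ∎)

    right : border v A · border w B ≋ I
    right i j = trans (border-· v w A B i j) (trans
      (border-cong (λ i → trans (+-congˡ (Aw≈-v i)) (-‿inverseʳ (v i))) (Invertible.inverseʳ A⁻¹) i j)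
      (1⊕-I i j))

    left : border w B · border v A ≋ I
    left i j = trans (border-· w v B A i j) (trans
      (border-cong w+Bv≈0 (Invertible.inverseˡ A⁻¹) i j)
      (1⊕-I i j))

  -- Trimming sums, and peeling block-diagonal matrices.

  sum-truncate : ∀ {m n} (f : ℕ → Carrier) → m ≤ n → (∀ l → m ≤ l → f l ≈ 0#) →
    sum {n} (f ∘ toℕ) ≈ sum {m} (f ∘ toℕ)
  sum-truncate {n = n} f z≤n       f≈0 = sum-zero {n} (f ∘ toℕ) (λ l → f≈0 (toℕ l) z≤n)
  sum-truncate f (s≤s m≤n) f≈0 = +-congˡ (sum-truncate (f ∘ suc) m≤n λ l m≤l → f≈0 (suc l) (s≤s m≤l))

  -- If `k` exceeds `n`, truncated subtraction makes the right-hand sum empty, and every term on the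
  -- left vanishes.
  sum-skip : ∀ k {n} (f : ℕ → Carrier) → (∀ l → l < k → f l ≈ 0#) →
    sum {n} (f ∘ toℕ) ≈ sum {n ∸ k} (λ l → f (k +ᴺ toℕ l))
  sum-skip zero            f f≈0 = refl
  sum-skip (suc k) {zero}  f f≈0 = refl
  sum-skip (suc k) {suc n} f f≈0 = begin
    f 0 + sum {n} (f ∘ suc ∘ toℕ)
      ≈⟨ +-cong (f≈0 0 (s≤s z≤n)) (sum-skip k (f ∘ suc) λ l l<k → f≈0 (suc l) (s≤s l<k)) ⟩
    0# + sum {n ∸ k} (λ l → f (suc k +ᴺ toℕ l))
      ≈⟨ +-identityˡ _ ⟩
    sum {n ∸ k} (λ l → f (suc k +ᴺ toℕ l))
      ∎

  -- `splitAt (suc p)` at `suc i` is computed from `splitAt p i`, so casing on the latter makes both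
  -- sides reduce.
  blockDiag-suc : ∀ {p q} (B : Matrix q) →
    blockDiag (I {suc p}) B ≋ 1⊕ blockDiag (I {p}) B
  blockDiag-suc B zero zero = refl
  blockDiag-suc {p} B zero (suc j) with splitAt p j
  ... | inj₁ _ = refl
  ... | inj₂ _ = refl
  blockDiag-suc {p} B (suc i) zero with splitAt p i
  ... | inj₁ _ = refl
  ... | inj₂ _ = refl
  blockDiag-suc {p} B (suc i) (suc j) with splitAt p i | splitAt p j
  ... | inj₁ _ | inj₁ _ = refl
  ... | inj₁ _ | inj₂ _ = refl
  ... | inj₂ _ | inj₁ _ = refl
  ... | inj₂ _ | inj₂ _ = refl

  if-does : ∀ {p} {P : Set p} {x y z} (P? : Dec P) → (P → x ≈ z) → (¬ P → y ≈ z) →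
    (if does P? then x else y) ≈ z
  if-does (yes p) x≈z y≈z = x≈z p
  if-does (no ¬p) x≈z y≈z = y≈z ¬p

  module _ (Λ : ℕ → Carrier) where

    -- The recurrence for `V`.

    toeplitz : ℕ → ℕ → Carrier
    toeplitz i j = if does (i <? j) then 0# else Λ (i ∸ j)

    toeplitz-upper : ∀ {i j} → i < j → toeplitz i j ≈ 0#
    toeplitz-upper {i} {j} i<j = if-does (i <? j) (λ _ → refl) (contradiction i<j)

    toeplitz-lower : ∀ {i j} → j ≤ i → toeplitz i j ≈ Λ (i ∸ j)
    toeplitz-lower {i} {j} j≤i =
      if-does (i <? j) (λ i<j → contradiction j≤i (<⇒≱ i<j)) (λ _ → refl)

    a-upper : ∀ {i j} → i < j → a Λ i j ≈ 0#
    a-upper {i} {suc j} i<j = if-does (i <? suc j) (λ _ → refl) (contradiction i<j)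

    -- One formula covers both branches: when `i < j` the sum has `suc i ∸ j = 0` terms, matching
    -- the value `0#`.
    a-suc : ∀ i j → a Λ (suc i) (suc j) ≈ sumFromTo j i (λ l → Λ (i ∸ l) * a Λ l j)
    a-suc i j = if-does (suc i <? suc j)
      (λ i<j → sym (empty (m≤n⇒m∸n≡0 (s≤s⁻¹ i<j))))
      (λ _ → refl)
      where
      empty : ∀ {n} {f : Vector Carrier n} → n ≡ 0 → sum f ≈ 0#
      empty ≡.refl = refl

    -- Terms with `l > i` vanish by the Toeplitz factor and those with `l < j` by triangularity of
    -- `a`; the surviving range is that of the defining recurrence.
    toeplitz-a : ∀ n i j → i ≤ n →
      sum {suc n} (λ l → toeplitz i (toℕ l) * a Λ (toℕ l) j) ≈ a Λ (suc i) (suc j)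
    toeplitz-a n i j i≤n = begin
      sum {suc n} (f ∘ toℕ)
        ≈⟨ sum-truncate f (s≤s i≤n) (λ l i<l → trans (*-congʳ (toeplitz-upper i<l)) (zeroˡ _)) ⟩
      sum {suc i} (f ∘ toℕ)
        ≈⟨ sum-skip j {suc i} f (λ l l<j → trans (*-congˡ (a-upper l<j)) (zeroʳ _)) ⟩
      sum {suc i ∸ j} (λ l → f (j +ᴺ toℕ l))
        ≈⟨ sum-cong-≋ {suc i ∸ j} (λ l → *-congʳ (toeplitz-lower (in-range l))) ⟩
      sumFromTo j i (λ l → Λ (i ∸ l) * a Λ l j)
        ≈⟨ a-suc i j ⟨
      a Λ (suc i) (suc j)
        ∎
      where
      f : ℕ → Carrier
      f l = toeplitz i l * a Λ l j

      in-range : (l : Fin (suc i ∸ j)) → j +ᴺ toℕ l ≤ i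
      -- If `i < j + l` then `suc i ∸ j ≤ l`, against the bound carried by `l`.
      in-range l = s≤s⁻¹ (≰⇒> λ i<j+l → <⇒≱ (toℕ<n l) (m≤n+o⇒m∸n≤o (suc i) j i<j+l))

    -- Column 0 of `1⊕ V Λ n` selects the first column of `T`, which is `Λ`. For successor indices
    -- the entries of `T` depend only on differences, so `toeplitz-a` applies.
    V-suc : ∀ n → V Λ (suc n) ≋ T Λ (suc n) · 1⊕ V Λ n
    V-suc n i zero = sym (begin
      Λ (toℕ i) * 1# + sum (λ l → T Λ (suc n) i (suc l) * 0#)
        ≈⟨ +-cong (*-identityʳ _) (sum-zero (λ l → T Λ (suc n) i (suc l) * 0#) (λ l → zeroʳ _)) ⟩
      Λ (toℕ i) + 0#
        ≈⟨ +-identityʳ _ ⟩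
      Λ (toℕ i)
        ∎)
    V-suc n zero (suc j) = sym (begin
      Λ 0 * 0# + sum (λ l → 0# * V Λ n l j)
        ≈⟨ +-cong (zeroʳ _) (sum-zero (λ l → 0# * V Λ n l j) (λ l → zeroˡ _)) ⟩
      0# + 0#
        ≈⟨ +-identityʳ _ ⟩
      0#
        ∎)
    V-suc n (suc i) (suc j) = sym (begin
      Λ (suc (toℕ i)) * 0# + sum (λ l → T Λ n i l * V Λ n l j)
        ≈⟨ +-cong (zeroʳ _) (toeplitz-a n (toℕ i) (toℕ j) (s≤s⁻¹ (toℕ<n i))) ⟩
      0# + V Λ (suc n) (suc i) (suc j)
        ≈⟨ +-identityˡ _ ⟩
      V Λ (suc n) (suc i) (suc j)
        ∎)

    -- Reducing `T̄` to `T` or to a smaller order.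

    -- The identity block has order p = n ∸ k in T̄, which does not compute for variable n;
    -- leaving p free lets it be replaced by an equal number.
    I⊕T : ∀ {n} p k → .(suc n ≡ p +ᴺ suc k) → Matrix (suc n)
    I⊕T p k eq i j = blockDiag (I {p}) (T Λ k) (cast eq i) (cast eq j)

    I⊕T-zero : ∀ {n p} → p ≡ 0 → .(eq : suc n ≡ p +ᴺ suc n) → I⊕T p n eq ≋ T Λ n
    I⊕T-zero ≡.refl eq i j =
      reflexive (≡.cong₂ (T Λ _) (cast-is-id eq i) (cast-is-id eq j))

    I⊕T-suc : ∀ {n k p q} → p ≡ suc q →
      .(eq : suc (suc n) ≡ p +ᴺ suc k) .(eq′ : suc n ≡ q +ᴺ suc k) →
      I⊕T p k eq ≋ 1⊕ I⊕T q k eq′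
    I⊕T-suc {k = k} ≡.refl eq eq′ i j =
      trans (blockDiag-suc (T Λ k) (cast eq i) (cast eq j)) (cast-1⊕ i j)
      where
      -- `cast` computes on `zero` and `suc` and its equation is irrelevant, so after casing the two
      -- sides coincide.
      cast-1⊕ : ∀ i j → (1⊕ blockDiag I (T Λ k)) (cast eq i) (cast eq j) ≈ (1⊕ I⊕T _ k eq′) i j
      cast-1⊕ zero    zero    = refl
      cast-1⊕ zero    (suc j) = refl
      cast-1⊕ (suc i) zero    = refl
      cast-1⊕ (suc i) (suc j) = refl

    -- The equation `k ≡ n` is an argument because the last index arrives as `suc (toℕ (fromℕ n))`,
    -- equal to `suc n` only propositionally. `T̄-suc` takes `k ≡ k′` likewise, for `inject₁`.
    T̄-full : ∀ {n k} (k≤n : k ≤ n) → k ≡ n → T̄ Λ n k k≤n ≋ T Λ n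
    T̄-full {n} k≤n ≡.refl = I⊕T-zero (n∸n≡0 n) (block-size k≤n)

    T̄-suc : ∀ {n k k′} (k≤1+n : k ≤ suc n) (k′≤n : k′ ≤ n) → k ≡ k′ →
      T̄ Λ (suc n) k k≤1+n ≋ 1⊕ T̄ Λ n k′ k′≤n
    T̄-suc k≤1+n k≤n ≡.refl =
      I⊕T-suc (+-∸-assoc 1 k≤n) (block-size k≤1+n) (block-size k≤n)

    -- The factorisation of `V`.

    V-factorisation : Λ 0 ≈ 1# → ∀ n → V Λ n ≋ ∏ (reverse (T̄s Λ n))
    -- The empty product is `I`, so the single entry `Λ 0` must be `1#`.
    V-factorisation Λ₀≈1 zero zero zero = Λ₀≈1
    V-factorisation Λ₀≈1 (suc n) i j = begin
      V Λ (suc n) i j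
        ≈⟨ V-suc n i j ⟩
      (T Λ (suc n) · 1⊕ V Λ n) i j
        ≈⟨ ·-cong {B′ = ∏ F} (λ i j → sym (T̄-full (toℕ<n (fromℕ n)) (≡.cong suc (toℕ-fromℕ n)) i j)) tail i j ⟩
      ∏ (reverse (T̄s Λ (suc n))) i j
        ∎
      where
      -- All factors after the first: `opposite zero` is `fromℕ n`, and `opposite (suc k)` is
      -- `inject₁ (opposite k)`.
      F : Vector (Matrix (suc (suc n))) n
      F = reverse (T̄s Λ (suc n) ∘ inject₁)

      tail : 1⊕ V Λ n ≋ ∏ F
      tail i j = begin
        (1⊕ V Λ n) i j
          ≈⟨ 1⊕-cong (V-factorisation Λ₀≈1 n) i j ⟩
        (1⊕ ∏ (reverse (T̄s Λ n))) i j
          ≈⟨ 1⊕-∏ (reverse (T̄s Λ n)) i j ⟩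
        ∏ (reverse (λ k → 1⊕ T̄s Λ n k)) i j
          ≈⟨ MonoidSum.sum-cong-≋ (matrixMonoid _) {x = F}
               (λ k i j → T̄-suc (toℕ<n (inject₁ (opposite k))) (toℕ<n (opposite k))
                  (≡.cong suc (toℕ-inject₁ (opposite k))) i j) i j ⟨
        ∏ F i j
          ∎

    -- Invertibility and the inverse of `V`.

    T-suc : Λ 0 ≈ 1# → ∀ k → border (λ i → Λ (suc (toℕ i))) (T Λ k) ≋ T Λ (suc k)
    T-suc Λ₀≈1 k zero    zero    = sym Λ₀≈1
    T-suc Λ₀≈1 k zero    (suc j) = refl
    T-suc Λ₀≈1 k (suc i) zero    = refl
    T-suc Λ₀≈1 k (suc i) (suc j) = refl

    T-invertible : Λ 0 ≈ 1# → ∀ k → Invertible (T Λ k)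
    T-invertible Λ₀≈1 zero = Invertible-resp I≋T₀ I-invertible
      where
      I≋T₀ : I ≋ T Λ 0
      I≋T₀ zero zero = sym Λ₀≈1
      I-invertible : Invertible (I {1})
      I-invertible = ⁻¹≈⇒Invertible I I (·-identityˡ I , ·-identityˡ I)
    T-invertible Λ₀≈1 (suc k) =
      Invertible-resp (T-suc Λ₀≈1 k) (border-invertible _ (T-invertible Λ₀≈1 k))

    -- Induction on `n` with `k` fixed: units are split off until `k ≡ n`, where `T̄` is `T`.
    T̄-invertible : Λ 0 ≈ 1# → ∀ n k (k≤n : k ≤ n) → Invertible (T̄ Λ n k k≤n)
    T̄-invertible Λ₀≈1 n k k≤n with m≤n⇒m<n∨m≡n k≤n
    ... | inj₂ k≡n =
      Invertible-resp (λ i j → sym (T̄-full k≤n k≡n i j)) (T-invertible Λ₀≈1 n)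
    ... | inj₁ (s≤s k≤n′) =
      Invertible-resp (λ i j → sym (T̄-suc k≤n k≤n′ ≡.refl i j))
        (border-invertible _ (T̄-invertible Λ₀≈1 _ k k≤n′))

    -- Taking arbitrary inverses of the factors lets this serve both the existence of an inverse of
    -- `V` and the formula for any given one.
    V-⁻¹≈ : Λ 0 ≈ 1# → ∀ n (T̄⁻¹ : (i : Fin n) → Invertible (T̄s Λ n i)) →
      V Λ n ⁻¹≈ ∏ (λ i → inverse (T̄⁻¹ i))
    V-⁻¹≈ Λ₀≈1 n T̄⁻¹ =
      Inv.⁻¹≈-respˡ {y = ∏ (λ i → inverse (T̄⁻¹ i))} (λ i j → sym (V-factorisation Λ₀≈1 n i j))
        (Inv.product-reverse-⁻¹≈ (T̄s Λ n) (λ i → inverse (T̄⁻¹ i)) (λ i → inverse-⁻¹≈ (T̄⁻¹ i)))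

-- Inverses are data here, so the formula ranges over every choice of them; uniqueness of two-sided
-- inverses then identifies any inverse of `V` with the product.
corollary2p5 :
    ∀ {c ℓ} (R : CommutativeRing c ℓ) →
      let open CommutativeRing R
          open Matrices R
      in
      (Λ : ℕ → Carrier) → Λ 0 ≈ 1# →
      (n : ℕ) → 1 ≤ n →
      (V Λ n ≋ ∏ (reverse (T̄s Λ n)))
      × Invertible (V Λ n)
      × ((i : Fin n) → Invertible (T̄s Λ n i))
      × ((V⁻¹ : Invertible (V Λ n)) (T̄⁻¹ : (i : Fin n) → Invertible (T̄s Λ n i)) →
           inverse V⁻¹ ≋ ∏ (λ i → inverse (T̄⁻¹ i)))
corollary2p5 R Λ Λ₀≈1 n _ =
    V-factorisation Λ Λ₀≈1 n
  , ⁻¹≈⇒Invertible (V Λ n) (∏ (λ i → inverse (T̄s-invertible i)))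
      (V-⁻¹≈ Λ Λ₀≈1 n T̄s-invertible)
  , T̄s-invertible
  , λ V⁻¹ T̄⁻¹ → Inv.⁻¹≈-unique {x = V Λ n} (inverse-⁻¹≈ V⁻¹) (V-⁻¹≈ Λ Λ₀≈1 n T̄⁻¹)
  where
  open Matrices R
  open MatrixProperties R

  T̄s-invertible : (i : Fin n) → Invertible (T̄s Λ n i)
  T̄s-invertible i = T̄-invertible Λ Λ₀≈1 n (suc (toℕ i)) (toℕ<n i)
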